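{- Let $n\ge 1$ and $k$ be integers with $\lfloor n/2\rfloor \le k\le \lfloor (2n-2)/3\rfloor$. Then $$|E(\Phi^n_k)|=\begin{cases}0, & k\in\left\{\frac{n-1}{2},\frac{2n-2}{3}\right\},\\[2pt] (2k-n+1)\binom{n-k-2}{2n-3k-3}, & \text{otherwise.}\end{cases}$$
   Context: A subword of a word is a block of consecutive letters. A binary word (over $\{0,1\}$) of length $n\ge 1$ is Padovan if it starts and ends with $0$, contains no subword $00$, and contains no subword $111$. For $n\ge1$ and $\lfloor n/2\rfloor\le k\le\lfloor(2n-2)/3\rfloor$, the weighted Padovan graph $\Phi^n_k$ is the simple graph whose vertices are all Padovan words of length $n$ with exactly $k$ letters $1$; two vertices are adjacent if one can be obtained from the other by replacing exactly one subword $01$ with $10$. In the claim, $\frac{n-1}{2}$ and $\frac{2n-2}{3}$ are rational numbers (no rounding). -}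

module Defs where

open import Data.Fin.Base using (Fin)
open import Data.Fin.Patterns using (0F; 1F)
open import Data.Fin.Properties using (_≟_)
open import Data.List.Base using (List; []; _∷_; _++_; length; filter; head; last)
open import Data.List.Properties using (∷-injectiveˡ; ++-cancelˡ)
open import Data.List.Relation.Binary.Infix.Heterogeneous using (Infix)
open import Data.Maybe.Base using (just)
open import Data.Nat.Base using (ℕ)
open import Data.Product.Base using (_×_; _,_; ∃₂)
open import Data.Sum.Base as Sum using (_⊎_; inj₁; inj₂)
open import Function.Bundles using (Bijection)
open import Level using (Level; 0ℓ; suc; _⊔_)
open import Relation.Binary.Bundles using (Setoid)
open import Relation.Binary.Core using (Rel)
open import Relation.Binary.Definitions using (Irreflexive; Symmetric; _Respects₂_)
open import Relation.Binary.PropositionalEquality using (_≡_; sym; trans; subst)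
import Relation.Binary.PropositionalEquality.Properties as ≡
import Relation.Binary.Construct.On as On
open import Relation.Nullary using (¬_)

HasCardinality : ∀ {a ℓ} → Setoid a ℓ → ℕ → Set (a ⊔ ℓ)
HasCardinality S m = Bijection (≡.setoid (Fin m)) S

record SimpleGraph (c ℓ r : Level) : Set (suc (c ⊔ ℓ ⊔ r)) where
  field
    vertexSetoid : Setoid c ℓ
  open Setoid vertexSetoid public renaming (Carrier to Vertex; refl to ≈-refl; sym to ≈-sym; trans to ≈-trans)
  field
    Adjacent     : Rel Vertex r
    adj-sym      : Symmetric Adjacent
    adj-irrefl   : Irreflexive _≈_ Adjacent
    adj-resp-≈   : Adjacent Respects₂ _≈_

  record Edge : Set (c ⊔ r) where
    constructor edge
    field
      end₁ end₂ : Vertex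
      adjacent  : Adjacent end₁ end₂

  open Edge

  -- Edges are unordered pairs: the order of the endpoints and the proof of
  -- adjacency are both irrelevant.
  infix 4 _≈ᴱ_
  _≈ᴱ_ : Rel Edge ℓ
  e ≈ᴱ f = (end₁ e ≈ end₁ f × end₂ e ≈ end₂ f) ⊎ (end₁ e ≈ end₂ f × end₂ e ≈ end₁ f)

  edgeSetoid : Setoid (c ⊔ r) ℓ
  edgeSetoid = record
    { Carrier = Edge
    ; _≈_ = _≈ᴱ_
    ; isEquivalence = record
      { refl  = inj₁ (≈-refl , ≈-refl)
      ; sym   = λ where
          (inj₁ (p , q)) → inj₁ (≈-sym p , ≈-sym q)
          (inj₂ (p , q)) → inj₂ (≈-sym q , ≈-sym p)
      ; trans = λ where
          (inj₁ (p , q)) (inj₁ (r , s)) → inj₁ (≈-trans p r , ≈-trans q s)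
          (inj₁ (p , q)) (inj₂ (r , s)) → inj₂ (≈-trans p r , ≈-trans q s)
          (inj₂ (p , q)) (inj₁ (r , s)) → inj₂ (≈-trans p s , ≈-trans q r)
          (inj₂ (p , q)) (inj₂ (r , s)) → inj₁ (≈-trans p s , ≈-trans q r)
      }
    }

Word : Set
Word = List (Fin 2)

infix 4 _IsSubwordOf_
_IsSubwordOf_ : Rel Word 0ℓ
_IsSubwordOf_ = Infix _≡_

record IsPadovan (w : Word) : Set where
  field
    starts-with-0 : head w ≡ just 0F
    ends-with-0   : last w ≡ just 0F
    no-00         : ¬ (0F ∷ 0F ∷ []) IsSubwordOf w
    no-111        : ¬ (1F ∷ 1F ∷ 1F ∷ []) IsSubwordOf w

ones : Word → ℕ
ones w = length (filter (_≟ 1F) w)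

-- Distinct inhabitants may share a word; Φ compares vertices by the word alone.
record PadovanWord (n k : ℕ) : Set where
  field
    word      : Word
    isPadovan : IsPadovan word
    length≡n  : length word ≡ n
    ones≡k    : ones word ≡ k

open PadovanWord

-- u ⟶ v: v is u with one subword 01 replaced by 10.
infix 4 _⟶_
_⟶_ : Rel Word 0ℓ
u ⟶ v = ∃₂ λ p s → u ≡ p ++ 0F ∷ 1F ∷ s × v ≡ p ++ 1F ∷ 0F ∷ s

⟶-irrefl : ∀ {u} → ¬ u ⟶ u
⟶-irrefl (p , s , eq , eq′) with ∷-injectiveˡ (++-cancelˡ p _ _ (trans (sym eq) eq′))
... | ()

Φ : ℕ → ℕ → SimpleGraph 0ℓ 0ℓ 0ℓ
Φ n k = record
  { vertexSetoid = On.setoid {B = PadovanWord n k} (≡.setoid Word) word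
  ; Adjacent     = λ u v → word u ⟶ word v ⊎ word v ⟶ word u
  ; adj-sym      = Sum.swap
  ; adj-irrefl   = λ {u} {v} u≈v → λ where
      (inj₁ r) → ⟶-irrefl (subst (_⟶ word v) u≈v r)
      (inj₂ r) → ⟶-irrefl (subst (word v ⟶_) u≈v r)
  ; adj-resp-≈   =
      (λ {u} v≈v′ → Sum.map (subst (word u ⟶_) v≈v′) (subst (_⟶ word u) v≈v′)) ,
      (λ {v} u≈u′ → Sum.map (subst (_⟶ word v) u≈u′) (subst (word v ⟶_) u≈u′))
  }

∣E_∣≡_ : ∀ {c ℓ r} → SimpleGraph c ℓ r → ℕ → Set (c ⊔ ℓ ⊔ r)
∣E G ∣≡ m = HasCardinality (SimpleGraph.edgeSetoid G) m

{-# OPTIONS --safe #-}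
-- A Padovan word is 0 1^c₁ 0 1^c₂ 0 … 1^cₘ 0 with every cᵢ ∈ {1, 2}.  If a of
-- the cᵢ are 1 and b are 2, then n = 2a + 3b + 1 and k = a + 2b, so n and k
-- determine a and b.  An edge of Φ replaces consecutive cᵢ = 1, cᵢ₊₁ = 2 by
-- 2, 1; edges are therefore sequences of a - 1 ones, b - 1 twos and one marker
-- in place of the exchanged pair.
module Submission where

open import Defs
open import Data.Empty using (⊥-elim)
open import Data.Fin.Base using (Fin)
open import Data.Fin.Patterns using (0F; 1F)
open import Data.Fin.Properties using (0↔⊥; 1↔⊤; +↔⊎)
open import Data.List.Base using ([]; _∷_; _++_; head; length; last)
open import Data.List.Properties using (∷-injectiveʳ)
open import Data.List.Relation.Binary.Infix.Heterogeneous using (here; there)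
open import Data.List.Relation.Binary.Prefix.Heterogeneous using (Prefix; []; _∷_)
open import Data.Maybe.Base using (just)
open import Data.Nat.Base using (ℕ; zero; suc; _+_; _*_; _∸_; _≤_; s≤s⁻¹)
open import Data.Nat.DivMod using (_/_; _%_; m≡m%n+[m/n]*n; m%n<n; m/n*n≤m)
open import Data.Nat.Combinatorics using (_C_; nCn≡1; nCk+nC[k+1]≡[n+1]C[k+1])
open import Data.Nat.Properties
open import Data.Nat.Tactic.RingSolver using (solve-∀)
open import Data.Integer.Base using (+_; _-_) renaming (_*_ to _*ℤ_)
open import Data.Integer.Properties as ℤ using (pos-*; +-injective)
open import Data.Rational.Base using () renaming (_/_ to _/ℚ_)
open import Data.Rational.Properties using (/-injective-≃; fromℚᵘ-cong)
open import Data.Rational.Unnormalised.Base using (mkℚᵘ; *≡*)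
open import Data.Product.Base using (_×_; _,_; ∃; ∃₂; proj₁; proj₂; Σ-syntax)
open import Data.Sum.Base using (_⊎_; inj₁; inj₂)
open import Data.Sum.Function.Propositional using (_⊎-↔_)
open import Data.Unit.Base using (tt)
open import Function.Base using (_∘_)
open import Function.Bundles using (Bijection; _↔_; mk↔ₛ′)
import Function.Construct.Composition as Compose
open import Function.Properties.Inverse using (Inverse⇒Bijection; ↔-trans)
open import Relation.Nullary using (¬_; contradiction)
open import Relation.Binary.PropositionalEquality

-- Counting block sequences, plain and marked.

data Blocks : ℕ → ℕ → Set where
  []  : Blocks 0 0
  one : ∀ {a b} → Blocks a b → Blocks (suc a) b
  two : ∀ {a b} → Blocks a b → Blocks a (suc b)

-- The indices count the blocks of either endpoint of the edge, so `mark`, which stands for one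
-- block of each kind, raises both. What follows `mark` is unmarked, hence there is exactly one
-- marker.
data MarkedBlocks : ℕ → ℕ → Set where
  mark : ∀ {a b} → Blocks a b → MarkedBlocks (suc a) (suc b)
  one  : ∀ {a b} → MarkedBlocks a b → MarkedBlocks (suc a) b
  two  : ∀ {a b} → MarkedBlocks a b → MarkedBlocks a (suc b)

blocks-one↔ : ∀ {a} → Blocks a 0 ↔ Blocks (suc a) 0
blocks-one↔ = mk↔ₛ′ one (λ { (one x) → x }) (λ { (one _) → refl }) (λ _ → refl)

blocks-two↔ : ∀ {b} → Blocks 0 b ↔ Blocks 0 (suc b)
blocks-two↔ = mk↔ₛ′ two (λ { (two x) → x }) (λ { (two _) → refl }) (λ _ → refl)

blocks-split↔ : ∀ {a b} →
  (Blocks a (suc b) ⊎ Blocks (suc a) b) ↔ Blocks (suc a) (suc b)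
blocks-split↔ = mk↔ₛ′
  (λ { (inj₁ x) → one x ; (inj₂ x) → two x })
  (λ { (one x) → inj₁ x ; (two x) → inj₂ x })
  (λ { (one _) → refl ; (two _) → refl })
  (λ { (inj₁ _) → refl ; (inj₂ _) → refl })

marked-split↔ : ∀ {a b} →
  (Blocks a b ⊎ MarkedBlocks a (suc b) ⊎ MarkedBlocks (suc a) b) ↔
  MarkedBlocks (suc a) (suc b)
marked-split↔ = mk↔ₛ′
  (λ { (inj₁ x) → mark x ; (inj₂ (inj₁ m)) → one m ; (inj₂ (inj₂ m)) → two m })
  (λ { (mark x) → inj₁ x ; (one m) → inj₂ (inj₁ m) ; (two m) → inj₂ (inj₂ m) })
  (λ { (mark _) → refl ; (one _) → refl ; (two _) → refl })
  (λ { (inj₁ _) → refl ; (inj₂ (inj₁ _)) → refl ; (inj₂ (inj₂ _)) → refl })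

blocks-pascal : ∀ a b →
  (a + suc b) C a + (suc a + b) C suc a ≡ (suc a + suc b) C suc a
blocks-pascal a b = begin
  (a + suc b) C a + (suc a + b) C suc a
    ≡⟨ cong (λ m → (a + suc b) C a + m C suc a) (+-suc a b) ⟨
  (a + suc b) C a + (a + suc b) C suc a
    ≡⟨ nCk+nC[k+1]≡[n+1]C[k+1] (a + suc b) a ⟩
  (suc a + suc b) C suc a ∎
  where open ≡-Reasoning

blocks↔ : ∀ a b → Fin ((a + b) C a) ↔ Blocks a b
blocks↔ zero zero =
  ↔-trans 1↔⊤ (mk↔ₛ′ (λ _ → []) (λ _ → tt) (λ { [] → refl }) (λ _ → refl))
blocks↔ zero (suc b) = ↔-trans (blocks↔ zero b) blocks-two↔
blocks↔ (suc a) zero =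
  ↔-trans (subst (λ m → Fin m ↔ Blocks a 0) C≡C (blocks↔ a 0)) blocks-one↔
  where
  C≡C : (a + 0) C a ≡ (suc a + 0) C suc a
  C≡C rewrite +-identityʳ a = trans (nCn≡1 a) (sym (nCn≡1 (suc a)))
blocks↔ (suc a) (suc b) = subst (λ m → Fin m ↔ Blocks (suc a) (suc b))
  (blocks-pascal a b)
  (↔-trans +↔⊎ (↔-trans (blocks↔ a (suc b) ⊎-↔ blocks↔ (suc a) b) blocks-split↔))

-- For positive counts this is the multinomial coefficient (a+b-1)! / ((a-1)! (b-1)! 1!) of
-- arrangements of a-1 ones, b-1 twos and one marker, written as b times a binomial. The factor `b`
-- makes it vanish at `b = 0`; a clause of its own does so at `a = 0`.
markedCount : ℕ → ℕ → ℕ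
markedCount zero    b = 0
markedCount (suc a) b = b * ((a + b) C a)

-- This is the recursion obtained from `marked-split↔` by looking at the first item: marker, one or
-- two.
markedCount-split : ∀ a b →
  (a + b) C a + (markedCount a (suc b) + markedCount (suc a) b) ≡
  markedCount (suc a) (suc b)
markedCount-split zero    b = refl
markedCount-split (suc a) b = begin
  -- The sequences starting with the marker contribute the single `t` missing from `b * t`; then
  -- both summands share the factor `suc b` and Pascal's rule applies.
  t + (suc b * s + b * t)                ≡⟨ rearrange b s t ⟩
  suc b * (s + t)                        ≡⟨ cong (suc b *_) (blocks-pascal a b) ⟩
  suc b * ((suc a + suc b) C suc a)      ∎
  where
  open ≡-Reasoning
  s t : ℕ
  s = (a + suc b) C a
  t = (suc a + b) C suc a
  rearrange : ∀ b s t → t + (suc b * s + b * t) ≡ suc b * (s + t)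
  rearrange = solve-∀

¬marked-0-b : ∀ {b} → ¬ MarkedBlocks 0 b
¬marked-0-b (two m) = ¬marked-0-b m

¬marked-a-0 : ∀ {a} → ¬ MarkedBlocks a 0
¬marked-a-0 (one m) = ¬marked-a-0 m

marked↔ : ∀ a b → Fin (markedCount a b) ↔ MarkedBlocks a b
marked↔ zero b =
  ↔-trans 0↔⊥ (mk↔ₛ′ (λ ()) ¬marked-0-b (⊥-elim ∘ ¬marked-0-b) (λ ()))
marked↔ (suc a) zero =
  ↔-trans 0↔⊥ (mk↔ₛ′ (λ ()) ¬marked-a-0 (⊥-elim ∘ ¬marked-a-0) (λ ()))
marked↔ (suc a) (suc b) = subst (λ m → Fin m ↔ MarkedBlocks (suc a) (suc b))
  (markedCount-split a b)
  (↔-trans +↔⊎ (↔-trans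
    (blocks↔ a b ⊎-↔ ↔-trans +↔⊎ (marked↔ a (suc b) ⊎-↔ marked↔ (suc a) b))
    marked-split↔))

-- Padovan words as block sequences.

-- Each block carries the 0 in front of it and `[]` supplies the closing 0. Thus every encoding
-- starts with 0, including the encoding of a remainder.
⟦_⟧ : ∀ {a b} → Blocks a b → Word
⟦ [] ⟧    = 0F ∷ []
⟦ one x ⟧ = 0F ∷ 1F ∷ ⟦ x ⟧
⟦ two x ⟧ = 0F ∷ 1F ∷ 1F ∷ ⟦ x ⟧

⟦⟧≢1∷ : ∀ {a b} (x : Blocks a b) {w} → ¬ ⟦ x ⟧ ≡ 1F ∷ w
⟦⟧≢1∷ []      ()
⟦⟧≢1∷ (one _) ()
⟦⟧≢1∷ (two _) ()

⟦⟧≢00∷ : ∀ {a b} (x : Blocks a b) {w} → ¬ ⟦ x ⟧ ≡ 0F ∷ 0F ∷ w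
⟦⟧≢00∷ []      ()
⟦⟧≢00∷ (one _) ()
⟦⟧≢00∷ (two _) ()

⟦⟧-tail : ∀ {a b} (x : Blocks a b) → ∃ λ w → ⟦ x ⟧ ≡ 0F ∷ w
⟦⟧-tail []      = _ , refl
⟦⟧-tail (one _) = _ , refl
⟦⟧-tail (two _) = _ , refl

-- The letter after an initial 01 reveals the first block: it is 1 for `two`, and for `one` it is
-- the 0 that opens the remainder.
⟦⟧-injective : ∀ {a b} (x y : Blocks a b) → ⟦ x ⟧ ≡ ⟦ y ⟧ → x ≡ y
⟦⟧-injective []      []      _  = refl
⟦⟧-injective (one x) (one y) eq =
  cong one (⟦⟧-injective x y (∷-injectiveʳ (∷-injectiveʳ eq)))
⟦⟧-injective (one x) (two y) eq =
  contradiction (∷-injectiveʳ (∷-injectiveʳ eq)) (⟦⟧≢1∷ x)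
⟦⟧-injective (two x) (one y) eq =
  contradiction (sym (∷-injectiveʳ (∷-injectiveʳ eq))) (⟦⟧≢1∷ y)
⟦⟧-injective (two x) (two y) eq =
  cong two (⟦⟧-injective x y (∷-injectiveʳ (∷-injectiveʳ (∷-injectiveʳ eq))))

length-⟦⟧ : ∀ {a b} (x : Blocks a b) → length ⟦ x ⟧ ≡ 1 + 2 * a + 3 * b
length-⟦⟧ [] = refl
length-⟦⟧ (one {a} {b} x) rewrite length-⟦⟧ x = lemma a b
  where
  lemma : ∀ a b → 2 + (1 + 2 * a + 3 * b) ≡ 1 + 2 * suc a + 3 * b
  lemma = solve-∀
length-⟦⟧ (two {a} {b} x) rewrite length-⟦⟧ x = lemma a b
  where
  lemma : ∀ a b → 3 + (1 + 2 * a + 3 * b) ≡ 1 + 2 * a + 3 * suc b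
  lemma = solve-∀

ones-⟦⟧ : ∀ {a b} (x : Blocks a b) → ones ⟦ x ⟧ ≡ a + 2 * b
ones-⟦⟧ []              = refl
ones-⟦⟧ (one x)         = cong suc (ones-⟦⟧ x)
ones-⟦⟧ (two {a} {b} x) rewrite ones-⟦⟧ x = lemma a b
  where
  lemma : ∀ a b → 2 + (a + 2 * b) ≡ a + 2 * suc b
  lemma = solve-∀

¬prefix-1∷ : ∀ {a b} (x : Blocks a b) {w} → ¬ Prefix _≡_ (1F ∷ w) ⟦ x ⟧
¬prefix-1∷ x p with ⟦ x ⟧ | ⟦⟧-tail x
¬prefix-1∷ x (() ∷ _) | _ | _ , refl

last-⟦⟧ : ∀ {a b} (x : Blocks a b) → last ⟦ x ⟧ ≡ just 0F
last-⟦⟧ []      = refl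
-- `last` passes over a letter only when the rest is visibly a cons, which `⟦⟧-tail` exposes.
last-⟦⟧ (one x) with ⟦ x ⟧ | ⟦⟧-tail x | last-⟦⟧ x
... | _ | _ , refl | eq = eq
last-⟦⟧ (two x) with ⟦ x ⟧ | ⟦⟧-tail x | last-⟦⟧ x
... | _ | _ , refl | eq = eq

⟦⟧-no-00 : ∀ {a b} (x : Blocks a b) → ¬ (0F ∷ 0F ∷ []) IsSubwordOf ⟦ x ⟧
⟦⟧-no-00 []      (here (_ ∷ ()))
⟦⟧-no-00 []      (there (here ()))
⟦⟧-no-00 (one x) (here (_ ∷ () ∷ _))
⟦⟧-no-00 (one x) (there (here (() ∷ _)))
⟦⟧-no-00 (one x) (there (there i)) = ⟦⟧-no-00 x i
⟦⟧-no-00 (two x) (here (_ ∷ () ∷ _))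
⟦⟧-no-00 (two x) (there (here (() ∷ _)))
⟦⟧-no-00 (two x) (there (there (here (() ∷ _))))
⟦⟧-no-00 (two x) (there (there (there i))) = ⟦⟧-no-00 x i

-- A block has at most two 1s, so an occurrence of 111 starting in it would need the next encoding
-- to begin with 1.
⟦⟧-no-111 : ∀ {a b} (x : Blocks a b) → ¬ (1F ∷ 1F ∷ 1F ∷ []) IsSubwordOf ⟦ x ⟧
⟦⟧-no-111 []      (here (() ∷ _))
⟦⟧-no-111 []      (there (here ()))
⟦⟧-no-111 (one x) (here (() ∷ _))
⟦⟧-no-111 (one x) (there (here (_ ∷ p)))          = ¬prefix-1∷ x p
⟦⟧-no-111 (one x) (there (there i))               = ⟦⟧-no-111 x i
⟦⟧-no-111 (two x) (here (() ∷ _))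
⟦⟧-no-111 (two x) (there (here (_ ∷ _ ∷ p)))      = ¬prefix-1∷ x p
⟦⟧-no-111 (two x) (there (there (here (_ ∷ p))))  = ¬prefix-1∷ x p
⟦⟧-no-111 (two x) (there (there (there i)))       = ⟦⟧-no-111 x i

⟦⟧-isPadovan : ∀ {a b} (x : Blocks a b) → IsPadovan ⟦ x ⟧
⟦⟧-isPadovan x = record
  { starts-with-0 = head-⟦⟧ x
  ; ends-with-0   = last-⟦⟧ x
  ; no-00         = ⟦⟧-no-00 x
  ; no-111        = ⟦⟧-no-111 x
  }
  where
  head-⟦⟧ : ∀ {a b} (x : Blocks a b) → head ⟦ x ⟧ ≡ just 0F
  head-⟦⟧ x rewrite proj₂ (⟦⟧-tail x) = refl

-- The letters up to the next 0 form one block; a missing 0, a 00 or a 111 is what the hypotheses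
-- exclude. Keeping the leading 0 outside the argument lets the recursion run on the part after the
-- next 0, which is structurally smaller.
parse-0∷ : ∀ w → last (0F ∷ w) ≡ just 0F →
  ¬ (0F ∷ 0F ∷ []) IsSubwordOf (0F ∷ w) →
  ¬ (1F ∷ 1F ∷ 1F ∷ []) IsSubwordOf (0F ∷ w) →
  ∃₂ λ a b → Σ[ x ∈ Blocks a b ] ⟦ x ⟧ ≡ 0F ∷ w
parse-0∷ []            _  _     _ = _ , _ , [] , refl
parse-0∷ (0F ∷ _)      _  no-00 _ = contradiction (here (refl ∷ refl ∷ [])) no-00
parse-0∷ (1F ∷ [])     () _     _
parse-0∷ (1F ∷ 0F ∷ w) l  no-00 no-111
  with parse-0∷ w l (no-00 ∘ there ∘ there) (no-111 ∘ there ∘ there)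
... | _ , _ , x , eq = _ , _ , one x , cong (λ v → 0F ∷ 1F ∷ v) eq
parse-0∷ (1F ∷ 1F ∷ [])     () _ _
parse-0∷ (1F ∷ 1F ∷ 0F ∷ w) l  no-00 no-111
  with parse-0∷ w l (no-00 ∘ there ∘ there ∘ there) (no-111 ∘ there ∘ there ∘ there)
... | _ , _ , x , eq = _ , _ , two x , cong (λ v → 0F ∷ 1F ∷ 1F ∷ v) eq
parse-0∷ (1F ∷ 1F ∷ 1F ∷ _) _ _ no-111 =
  contradiction (there (here (refl ∷ refl ∷ refl ∷ []))) no-111

parse : ∀ {w} → IsPadovan w → ∃₂ λ a b → Σ[ x ∈ Blocks a b ] ⟦ x ⟧ ≡ w
parse {[]}     p with () ← IsPadovan.starts-with-0 p
parse {1F ∷ _} p with () ← IsPadovan.starts-with-0 p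
parse {0F ∷ w} p = parse-0∷ w ends-with-0 no-00 no-111
  where open IsPadovan p

-- Exchanges of letters as marked block sequences.

lower upper : ∀ {a b} → MarkedBlocks a b → Blocks a b
lower (mark x) = one (two x)
lower (one m)  = one (lower m)
lower (two m)  = two (lower m)
upper (mark x) = two (one x)
upper (one m)  = one (upper m)
upper (two m)  = two (upper m)

∷-⟶ : ∀ {u v} c → u ⟶ v → (c ∷ u) ⟶ (c ∷ v)
∷-⟶ c (p , s , eq , eq′) = c ∷ p , s , cong (c ∷_) eq , cong (c ∷_) eq′

lower⟶upper : ∀ {a b} (m : MarkedBlocks a b) → ⟦ lower m ⟧ ⟶ ⟦ upper m ⟧
-- 01·01·1 becomes 01·10·1: the 0 separating the two blocks moves one place to the right.
lower⟶upper (mark x) = 0F ∷ 1F ∷ [] , 1F ∷ ⟦ x ⟧ , refl , refl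
lower⟶upper (one m)  = ∷-⟶ 0F (∷-⟶ 1F (lower⟶upper m))
lower⟶upper (two m)  = ∷-⟶ 0F (∷-⟶ 1F (∷-⟶ 1F (lower⟶upper m)))

IsMarked : ∀ {a b} → Blocks a b → Blocks a b → Set
IsMarked {a} {b} x y = Σ[ m ∈ MarkedBlocks a b ] lower m ≡ x × upper m ≡ y

-- Equal leading blocks are peeled off together with their letters in `p`. At the first block where
-- `x` and `y` differ, the first changed letter turns from 0 to 1, so `x` must have `one` there and
-- `y` must have `two`.
⟶⇒marked : ∀ {a b} (x y : Blocks a b) p {s} →
  ⟦ x ⟧ ≡ p ++ 0F ∷ 1F ∷ s → ⟦ y ⟧ ≡ p ++ 1F ∷ 0F ∷ s → IsMarked x y
⟶⇒marked x y [] _ e′ = contradiction e′ (⟦⟧≢1∷ y)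
⟶⇒marked (one x) y (_ ∷ []) e _ = contradiction (∷-injectiveʳ e) λ ()
⟶⇒marked (one x) (one y) (_ ∷ _ ∷ p) e e′
  with ⟶⇒marked x y p (∷-injectiveʳ (∷-injectiveʳ e)) (∷-injectiveʳ (∷-injectiveʳ e′))
... | m , refl , refl = one m , refl , refl
-- The words already differ in the third letter, so `exchange` shows that the rest of the prefix is
-- empty and identifies the next blocks.
⟶⇒marked (one x) (two y) (_ ∷ _ ∷ p) e e′ =
  exchange x y p (∷-injectiveʳ (∷-injectiveʳ e)) (∷-injectiveʳ (∷-injectiveʳ e′))
  where
  exchange : ∀ {a b} (x : Blocks a (suc b)) (y : Blocks (suc a) b) p {s} →
    ⟦ x ⟧ ≡ p ++ 0F ∷ 1F ∷ s → 1F ∷ ⟦ y ⟧ ≡ p ++ 1F ∷ 0F ∷ s →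
    IsMarked (one x) (two y)
  exchange x y (1F ∷ p) e e′ = contradiction e (⟦⟧≢1∷ x)
  exchange x y (0F ∷ p) e ()
  -- If the next block of `x` were also `one`, moving its 0 to the right would put it against the
  -- following 0, giving 00.
  exchange (one x) y [] refl e′ = contradiction (∷-injectiveʳ e′) (⟦⟧≢0⟦⟧ y x)
    where
    ⟦⟧≢0⟦⟧ : ∀ {a b c d} (y : Blocks a b) (x : Blocks c d) → ¬ ⟦ y ⟧ ≡ 0F ∷ ⟦ x ⟧
    ⟦⟧≢0⟦⟧ y x eq = ⟦⟧≢00∷ y (trans eq (cong (0F ∷_) (proj₂ (⟦⟧-tail x))))
  -- Of the 011 that opens the next block, one 1 joins the preceding block and 01 remains, so `y`
  -- continues with `one x`.
  exchange (two x) y [] refl e′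
    with refl ← ⟦⟧-injective y (one x) (∷-injectiveʳ e′) = mark x , refl , refl
⟶⇒marked (two x) y (_ ∷ []) e _ = contradiction (∷-injectiveʳ e) λ ()
⟶⇒marked (two x) y (_ ∷ _ ∷ []) e _ =
  contradiction (∷-injectiveʳ (∷-injectiveʳ e)) λ ()
⟶⇒marked (two x) (one y) (0F ∷ 1F ∷ 1F ∷ p) e e′ =
  contradiction (∷-injectiveʳ (∷-injectiveʳ e′)) (⟦⟧≢1∷ y)
⟶⇒marked (two x) (two y) (_ ∷ _ ∷ _ ∷ p) e e′
  with ⟶⇒marked x y p (∷-injectiveʳ (∷-injectiveʳ (∷-injectiveʳ e)))
                      (∷-injectiveʳ (∷-injectiveʳ (∷-injectiveʳ e′)))
... | m , refl , refl = two m , refl , refl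
⟶⇒marked [] y (_ ∷ []) () _
⟶⇒marked [] y (_ ∷ _ ∷ _) () _

one-injective : ∀ {a b} {x y : Blocks a b} → one x ≡ one y → x ≡ y
one-injective refl = refl

two-injective : ∀ {a b} {x y : Blocks a b} → two x ≡ two y → x ≡ y
two-injective refl = refl

-- One endpoint alone may allow several markers; with both, the marker sits where they first differ.
ends-injective : ∀ {a b} (m m′ : MarkedBlocks a b) →
  lower m ≡ lower m′ → upper m ≡ upper m′ → m ≡ m′
ends-injective (mark x) (mark .x) refl _  = refl
ends-injective (mark _) (one _)   _    ()
ends-injective (mark _) (two _)   ()   _
ends-injective (one _)  (mark _)  _    ()
ends-injective (one m)  (one m′)  e    e′ =
  cong one (ends-injective m m′ (one-injective e) (one-injective e′))
ends-injective (one _)  (two _)   ()   _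
ends-injective (two _)  (mark _)  ()   _
ends-injective (two _)  (one _)   ()   _
ends-injective (two m)  (two m′)  e    e′ =
  cong two (ends-injective m m′ (two-injective e) (two-injective e′))

-- At the first difference `lower` has `one` and `upper` has `two`, so the roles cannot be reversed.
-- Hence no edge, taken as an unordered pair, arises from two markings with swapped ends.
ends-asym : ∀ {a b} (m m′ : MarkedBlocks a b) →
  lower m ≡ upper m′ → ¬ upper m ≡ lower m′
ends-asym (mark _) (one _)  _  ()
ends-asym (mark _) (two _)  () _
ends-asym (one _)  (mark _) () _
ends-asym (one m)  (one m′) e  e′ =
  ends-asym m m′ (one-injective e) (one-injective e′)
ends-asym (one _)  (two _)  () _
ends-asym (two _)  (mark _) _  ()
ends-asym (two _)  (one _)  () _
ends-asym (two m)  (two m′) e  e′ =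
  ends-asym m m′ (two-injective e) (two-injective e′)

-- Vertices and edges of the graph for given block counts.

block-counts-unique : ∀ a b a′ b′ →
  1 + 2 * a + 3 * b ≡ 1 + 2 * a′ + 3 * b′ → a + 2 * b ≡ a′ + 2 * b′ →
  a ≡ a′ × b ≡ b′
block-counts-unique a b a′ b′ n≡ k≡ = a≡ b≡ , b≡
  where
  -- In terms of n and k this is n + b = 2k + 1, which determines b; then k determines a.
  twice-k : ∀ a b → 1 + 2 * a + 3 * b + b ≡ 1 + 2 * (a + 2 * b)
  twice-k = solve-∀
  b≡ : b ≡ b′
  b≡ = +-cancelˡ-≡ (1 + 2 * a + 3 * b) _ _ (begin
    1 + 2 * a + 3 * b + b     ≡⟨ twice-k a b ⟩
    1 + 2 * (a + 2 * b)       ≡⟨ cong (λ k → 1 + 2 * k) k≡ ⟩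
    1 + 2 * (a′ + 2 * b′)     ≡⟨ twice-k a′ b′ ⟨
    1 + 2 * a′ + 3 * b′ + b′  ≡⟨ cong (_+ b′) n≡ ⟨
    1 + 2 * a + 3 * b + b′    ∎)
    where open ≡-Reasoning
  a≡ : b ≡ b′ → a ≡ a′
  a≡ refl = +-cancelʳ-≡ (2 * b) _ _ k≡

module _ (a b : ℕ) where

  private
    n k : ℕ
    n = 1 + 2 * a + 3 * b
    k = a + 2 * b

  open SimpleGraph (Φ n k) using (Vertex; Edge; edge; edgeSetoid; _≈ᴱ_)
  open PadovanWord

  vertex : Blocks a b → Vertex
  vertex x = record
    { word      = ⟦ x ⟧
    ; isPadovan = ⟦⟧-isPadovan x
    ; length≡n  = length-⟦⟧ x
    ; ones≡k    = ones-⟦⟧ x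
    }

  vertex-surjective : (v : Vertex) → Σ[ x ∈ Blocks a b ] ⟦ x ⟧ ≡ word v
  vertex-surjective v with parse (isPadovan v)
  ... | a′ , b′ , x , eq
    with refl , refl ← block-counts-unique a′ b′ a b
           (trans (sym (length-⟦⟧ x)) (trans (cong length eq) (length≡n v)))
           (trans (sym (ones-⟦⟧ x)) (trans (cong ones eq) (ones≡k v)))
    = x , eq

  toEdge : MarkedBlocks a b → Edge
  toEdge m = edge (vertex (lower m)) (vertex (upper m)) (inj₁ (lower⟶upper m))

  toEdge-injective : ∀ {m m′} → toEdge m ≈ᴱ toEdge m′ → m ≡ m′
  toEdge-injective {m} {m′} (inj₁ (e , e′)) =
    ends-injective m m′ (⟦⟧-injective _ _ e) (⟦⟧-injective _ _ e′)
  toEdge-injective {m} {m′} (inj₂ (e , e′)) = contradiction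
    (⟦⟧-injective _ _ e′) (ends-asym m m′ (⟦⟧-injective _ _ e))

  ⟶⇒toEdge : ∀ u v → word u ⟶ word v →
    Σ[ m ∈ MarkedBlocks a b ] ⟦ lower m ⟧ ≡ word u × ⟦ upper m ⟧ ≡ word v
  ⟶⇒toEdge u v (p , s , e , e′)
    with x , eq ← vertex-surjective u | y , eq′ ← vertex-surjective v
    with ⟶⇒marked x y p (trans eq e) (trans eq′ e′)
  ... | m , refl , refl = m , eq , eq′

  toEdge-surjective : (e : Edge) → Σ[ m ∈ MarkedBlocks a b ] toEdge m ≈ᴱ e
  toEdge-surjective (edge u v (inj₁ u⟶v)) with ⟶⇒toEdge u v u⟶v
  ... | m , e , e′ = m , inj₁ (e , e′)
  -- An edge listed against the direction of `⟶` is reached with its ends swapped.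
  toEdge-surjective (edge u v (inj₂ v⟶u)) with ⟶⇒toEdge v u v⟶u
  ... | m , e , e′ = m , inj₂ (e , e′)

  marked⤖edges : Bijection (setoid (MarkedBlocks a b)) edgeSetoid
  marked⤖edges = record
    { to        = toEdge
    ; cong      = λ { refl → inj₁ (refl , refl) }
    ; bijective = toEdge-injective , λ e →
        proj₁ (toEdge-surjective e) , λ { refl → proj₂ (toEdge-surjective e) }
    }

  ∣E∣≡markedCount : ∣E Φ n k ∣≡ markedCount a b
  ∣E∣≡markedCount =
    Compose.bijection (Inverse⇒Bijection (marked↔ a b)) marked⤖edges

-- Block counts from the bounds on n and k.

block-counts-exist : ∀ {n k} → n ≤ 2 * k + 1 → 3 * k + 2 ≤ 2 * n →
  ∃₂ λ a b → n ≡ 1 + 2 * a + 3 * b × k ≡ a + 2 * b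
block-counts-exist {n} {k} n≤2k+1 3k+2≤2n
  -- The slacks of the two inequalities are the block counts: b = 2k + 1 - n and a = 2n - 3k - 2.
  with b , 2k+1≡n+b ← m≤n⇒∃[o]m+o≡n n≤2k+1
     | a , 2n≡3k+2+a ← m≤n⇒∃[o]m+o≡n 3k+2≤2n
  = a , b , n≡ , k≡
  where
  open ≡-Reasoning
  k≡ : k ≡ a + 2 * b
  k≡ = +-cancelˡ-≡ (3 * k + 2) _ _ (begin
    3 * k + 2 + k            ≡⟨ lemma₁ k ⟩
    2 * (2 * k + 1)          ≡⟨ cong (2 *_) 2k+1≡n+b ⟨
    2 * (n + b)              ≡⟨ *-distribˡ-+ 2 n b ⟩
    2 * n + 2 * b            ≡⟨ cong (_+ 2 * b) 2n≡3k+2+a ⟨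
    3 * k + 2 + a + 2 * b    ≡⟨ +-assoc (3 * k + 2) a (2 * b) ⟩
    3 * k + 2 + (a + 2 * b)  ∎)
    where
    lemma₁ : ∀ k → 3 * k + 2 + k ≡ 2 * (2 * k + 1)
    lemma₁ = solve-∀
  n≡ : n ≡ 1 + 2 * a + 3 * b
  n≡ = +-cancelʳ-≡ b _ _ (begin
    n + b                    ≡⟨ 2k+1≡n+b ⟩
    2 * k + 1                ≡⟨ cong (λ k → 2 * k + 1) k≡ ⟩
    2 * (a + 2 * b) + 1      ≡⟨ lemma₂ a b ⟩
    1 + 2 * a + 3 * b + b    ∎)
    where
    lemma₂ : ∀ a b → 2 * (a + 2 * b) + 1 ≡ 1 + 2 * a + 3 * b + b
    lemma₂ = solve-∀

-- The extra 1 absorbs the remainder of n modulo 2.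
n/2≤k⇒n≤2k+1 : ∀ {n k} → n / 2 ≤ k → n ≤ 2 * k + 1
n/2≤k⇒n≤2k+1 {n} {k} n/2≤k = begin
  n                    ≡⟨ m≡m%n+[m/n]*n n 2 ⟩
  n % 2 + n / 2 * 2    ≤⟨ +-mono-≤ (s≤s⁻¹ (m%n<n n 2)) (*-monoˡ-≤ 2 n/2≤k) ⟩
  1 + k * 2            ≡⟨ +-comm 1 (k * 2) ⟩
  k * 2 + 1            ≡⟨ cong (_+ 1) (*-comm k 2) ⟩
  2 * k + 1            ∎
  where open ≤-Reasoning

k≤[2n-2]/3⇒3k+2≤2n : ∀ {n k} → 1 ≤ n → k ≤ (2 * n ∸ 2) / 3 → 3 * k + 2 ≤ 2 * n
k≤[2n-2]/3⇒3k+2≤2n {n} {k} 1≤n k≤ = begin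
  3 * k + 2                    ≡⟨ cong (_+ 2) (*-comm 3 k) ⟩
  k * 3 + 2                    ≤⟨ +-monoˡ-≤ 2 (*-monoˡ-≤ 3 k≤) ⟩
  (2 * n ∸ 2) / 3 * 3 + 2      ≤⟨ +-monoˡ-≤ 2 (m/n*n≤m (2 * n ∸ 2) 3) ⟩
  -- Since `1 ≤ n`, the subtraction is not truncated and adding 2 undoes it.
  2 * n ∸ 2 + 2                ≡⟨ m∸n+n≡m (*-monoʳ-≤ 2 1≤n) ⟩
  2 * n                        ∎
  where open ≤-Reasoning

-- The exceptional values of k and the closed formula.

k/1≡m/d⇒k*d≡m : ∀ k m d → + k /ℚ 1 ≡ + m /ℚ suc d → k * suc d ≡ m
k/1≡m/d⇒k*d≡m k m d eq
  -- Equality of normalised rationals is pulled back to unnormalised fractions, where it is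
  -- cross-multiplication; `mkℚᵘ` stores the denominator less one.
  with *≡* k*d≡m*1 ← /-injective-≃ (mkℚᵘ (+ k) 0) (mkℚᵘ (+ m) d) eq =
  +-injective (trans (pos-* k (suc d)) (trans k*d≡m*1 (ℤ.*-identityʳ (+ m))))

k*d≡m⇒k/1≡m/d : ∀ k m d → k * suc d ≡ m → + k /ℚ 1 ≡ + m /ℚ suc d
k*d≡m⇒k/1≡m/d k m d refl = fromℚᵘ-cong {mkℚᵘ (+ k) 0} {mkℚᵘ (+ m) d}
  (*≡* (trans (sym (pos-* k (suc d))) (sym (ℤ.*-identityʳ (+ m)))))

-- With n = 1 + m the numerator n - 1 reduces to m by computation, but 2n - 2 gets stuck and needs
-- this equation.
2[1+m]-2≡2m : ∀ m → + 2 *ℤ + suc m - + 2 ≡ + (2 * m)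
2[1+m]-2≡2m m = cong (_- + 2)
  (trans (sym (pos-* 2 (suc m))) (cong +_ (*-suc 2 m)))

Exceptional : ℕ → ℕ → Set
Exceptional n k =
  ((+ k) /ℚ 1 ≡ (+ n - + 1) /ℚ 2) ⊎ ((+ k) /ℚ 1 ≡ ((+ 2) *ℤ (+ n) - + 2) /ℚ 3)

-- Since 2k - (n - 1) = b and 2(n - 1) - 3k = a, the two exceptional values are those at which one
-- kind of block is absent.
exceptional⇒a≡0⊎b≡0 : ∀ a b →
  Exceptional (1 + 2 * a + 3 * b) (a + 2 * b) → a ≡ 0 ⊎ b ≡ 0
exceptional⇒a≡0⊎b≡0 a b (inj₁ eq) = inj₂ (+-cancelˡ-≡ (2 * a + 3 * b) _ _
  (trans (lemma a b) (trans
    (k/1≡m/d⇒k*d≡m (a + 2 * b) (2 * a + 3 * b) 1 eq)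
    (sym (+-identityʳ _)))))
  where
  lemma : ∀ a b → 2 * a + 3 * b + b ≡ (a + 2 * b) * 2
  lemma = solve-∀
exceptional⇒a≡0⊎b≡0 a b (inj₂ eq) = inj₁ (sym (+-cancelˡ-≡ ((a + 2 * b) * 3) _ _
  (trans (+-identityʳ _) (trans
    (k/1≡m/d⇒k*d≡m (a + 2 * b) (2 * (2 * a + 3 * b)) 2
      (trans eq (cong (_/ℚ 3) (2[1+m]-2≡2m (2 * a + 3 * b)))))
    (lemma a b)))))
  where
  lemma : ∀ a b → 2 * (2 * a + 3 * b) ≡ (a + 2 * b) * 3 + a
  lemma = solve-∀

b≡0⇒exceptional : ∀ a → Exceptional (1 + 2 * a + 3 * 0) (a + 2 * 0)
b≡0⇒exceptional a = inj₁ (k*d≡m⇒k/1≡m/d (a + 2 * 0) (2 * a + 3 * 0) 1 (lemma a))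
  where
  lemma : ∀ a → (a + 2 * 0) * 2 ≡ 2 * a + 3 * 0
  lemma = solve-∀

a≡0⇒exceptional : ∀ b → Exceptional (1 + 2 * 0 + 3 * b) (0 + 2 * b)
a≡0⇒exceptional b = inj₂ (trans
  (k*d≡m⇒k/1≡m/d (2 * b) (2 * (3 * b)) 2 (lemma b))
  (cong (_/ℚ 3) (sym (2[1+m]-2≡2m (3 * b)))))
  where
  lemma : ∀ b → (2 * b) * 3 ≡ 2 * (3 * b)
  lemma = solve-∀

exceptional⇒markedCount≡0 : ∀ a b →
  Exceptional (1 + 2 * a + 3 * b) (a + 2 * b) → markedCount a b ≡ 0
exceptional⇒markedCount≡0 a b exc with exceptional⇒a≡0⊎b≡0 a b exc
... | inj₁ refl = refl
... | inj₂ refl = markedCount-a-0 a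
  where
  markedCount-a-0 : ∀ a → markedCount a 0 ≡ 0
  markedCount-a-0 zero    = refl
  markedCount-a-0 (suc _) = refl

-- Both counts are positive here, so no subtraction is truncated: 2k + 1 - n = b, n - k - 2 = a + b
-- - 1 and 2n - 3k - 3 = a - 1. The last clause has `suc a` and `suc b` in place of a and b.
¬exceptional⇒markedCount : ∀ a b →
  let n = 1 + 2 * a + 3 * b ; k = a + 2 * b in ¬ Exceptional n k →
  markedCount a b ≡ (2 * k + 1 ∸ n) * ((n ∸ k ∸ 2) C (2 * n ∸ 3 * k ∸ 3))
¬exceptional⇒markedCount zero b ¬exc = contradiction (a≡0⇒exceptional b) ¬exc
¬exceptional⇒markedCount a@(suc _) zero ¬exc =
  contradiction (b≡0⇒exceptional a) ¬exc
¬exceptional⇒markedCount (suc a) (suc b) _ = sym (cong₂ _*_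
  (trans (cong (_∸ n) (b-lemma a b)) (m+n∸m≡n n (suc b)))
  (cong₂ _C_
    (trans (∸-+-assoc n k 2)
      (trans (cong (_∸ (k + 2)) (a+b-lemma a b)) (m+n∸m≡n (k + 2) (a + suc b))))
    (trans (∸-+-assoc (2 * n) (3 * k) 3)
      (trans (cong (_∸ (3 * k + 3)) (a-lemma a b)) (m+n∸m≡n (3 * k + 3) a)))))
  where
  n k : ℕ
  n = 1 + 2 * suc a + 3 * suc b
  k = suc a + 2 * suc b
  b-lemma : ∀ a b →
    2 * (suc a + 2 * suc b) + 1 ≡ 1 + 2 * suc a + 3 * suc b + suc b
  b-lemma = solve-∀
  a+b-lemma : ∀ a b →
    1 + 2 * suc a + 3 * suc b ≡ suc a + 2 * suc b + 2 + (a + suc b)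
  a+b-lemma = solve-∀
  a-lemma : ∀ a b →
    2 * (1 + 2 * suc a + 3 * suc b) ≡ 3 * (suc a + 2 * suc b) + 3 + a
  a-lemma = solve-∀

corollary3p3 : (n k : ℕ) → 1 ≤ n → n / 2 ≤ k → k ≤ (2 * n ∸ 2) / 3 →
    let exceptional = ((+ k) /ℚ 1 ≡ (+ n - + 1) /ℚ 2) ⊎ ((+ k) /ℚ 1 ≡ ((+ 2) *ℤ (+ n) - + 2) /ℚ 3)
    in (exceptional → ∣E Φ n k ∣≡ 0) ×
    (¬ exceptional → ∣E Φ n k ∣≡ ((2 * k + 1 ∸ n) * ((n ∸ k ∸ 2) C (2 * n ∸ 3 * k ∸ 3))))
corollary3p3 n k 1≤n n/2≤k k≤[2n-2]/3
  with a , b , refl , refl ← block-counts-exist {n} {k} (n/2≤k⇒n≤2k+1 n/2≤k)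
           (k≤[2n-2]/3⇒3k+2≤2n 1≤n k≤[2n-2]/3)
  = (λ exc → subst (∣E Φ n k ∣≡_)
      (exceptional⇒markedCount≡0 a b exc) (∣E∣≡markedCount a b))
  , (λ ¬exc → subst (∣E Φ n k ∣≡_)
      (¬exceptional⇒markedCount a b ¬exc) (∣E∣≡markedCount a b))
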